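{- Let $B$ be a finite subset of $\mathrm{N}$. Then $\mathrm{SAT}(\{\mathsf{F},\mathsf{G},\mathsf{X},\mathsf{U},\mathsf{S}\},B)$ can be decided in polynomial time.
   Context: A Boolean function is a map $f:\{0,1\}^n\to\{0,1\}$; each is used as an $n$-ary propositional connective. $\mathrm{N}$ is the set of Boolean functions that depend on at most one variable (it is generated by negation and the constants $0,1$). A temporal $B$-formula over a set $M$ of temporal operators is built from propositional variables using connectives from $B$ and operators from $M$. A structure $S=(s,V,\xi)$ is an infinite sequence $(s_i)_{i\in\mathbb N}$ of distinct states, a variable set $V$, and $\xi$ assigning to each state the set of variables true there. Semantics: $S,s_i\models x$ iff $x\in\xi(s_i)$; Boolean connectives pointwise; $S,s_i\models\mathsf{X}\varphi$ iff $S,s_{i+1}\models\varphi$; $S,s_i\models\varphi_1\mathsf{U}\varphi_2$ iff some $k\ge i$ has $S,s_k\models\varphi_2$ and $S,s_j\models\varphi_1$ for all $i\le j<k$; $S,s_i\models\varphi_1\mathsf{S}\varphi_2$ iff some $k\le i$ has $S,s_k\models\varphi_2$ and $S,s_j\models\varphi_1$ for all $k<j\le i$; $\mathsf{F}\varphi=\mathrm{true}\,\mathsf{U}\,\varphi$, $\mathsf{G}\varphi=\neg\mathsf{F}\neg\varphi$. A formula is satisfiable if it holds at some state of some structure. $\mathrm{SAT}(M,B)$ is the problem of deciding satisfiability of temporal $B$-formulae over $M$. -}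

module Defs where

open import Data.Nat using (ℕ; zero; suc; _+_; _*_; _^_; _≤_; _<_; _≡ᵇ_)
open import Data.Nat.Binary using (ℕᵇ; zero; 2[1+_]; 1+[2_])
open import Data.Bool using (Bool; true; false; if_then_else_)
open import Data.Fin using (Fin)
open import Data.Vec using (Vec; []; _∷_; lookup)
open import Data.List using (List; []; _∷_; _++_; length)
import Data.List as List
open import Data.List.Relation.Unary.All using (All)
open import Data.Maybe using (Maybe; just; nothing)
open import Data.Sum using (_⊎_; inj₁; inj₂)
open import Data.Product using (Σ; _×_; _,_; proj₁; proj₂; ∃)
open import Relation.Binary.PropositionalEquality using (_≡_)
open import Relation.Nullary using (¬_)
open import Function.Bundles using (_⇔_)

BoolFun : Set
BoolFun = Σ ℕ λ n → (Vec Bool n → Bool)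

arity : BoolFun → ℕ
arity = proj₁

Constant : BoolFun → Set
Constant (n , f) = ∀ (u v : Vec Bool n) → f u ≡ f v

DependsOnlyOn : (b : BoolFun) → Fin (arity b) → Set
DependsOnlyOn (n , f) i = ∀ (u v : Vec Bool n) → lookup u i ≡ lookup v i → f u ≡ f v

InN : BoolFun → Set
InN b = Constant b ⊎ Σ (Fin (arity b)) (DependsOnlyOn b)

data Formula (B : List BoolFun) : Set where
  var  : ℕᵇ → Formula B
  conn : (c : Fin (length B)) → Vec (Formula B) (arity (List.lookup B c)) → Formula B
  `F `G `X : Formula B → Formula B
  _`U_ _`S_ : Formula B → Formula B → Formula B

-- Semantics. A structure is given by ξ : states (ℕ) → variables → Bool.

Structure : Set
Structure = ℕ → ℕᵇ → Bool

mutual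
  _,_⊨_ : {B : List BoolFun} → Structure → ℕ → Formula B → Set
  ξ , i ⊨ var x = ξ i x ≡ true
  _,_⊨_ {B} ξ i (conn c φs) =
    Σ (Vec Bool (arity (List.lookup B c))) λ bs →
      Agrees ξ i φs bs × proj₂ (List.lookup B c) bs ≡ true
  ξ , i ⊨ `X φ = ξ , suc i ⊨ φ
  ξ , i ⊨ (φ `U ψ) = Σ ℕ λ k → i ≤ k × ξ , k ⊨ ψ × (∀ j → i ≤ j → j < k → ξ , j ⊨ φ)
  ξ , i ⊨ (φ `S ψ) = Σ ℕ λ k → k ≤ i × ξ , k ⊨ ψ × (∀ j → k < j → j ≤ i → ξ , j ⊨ φ)
  -- F φ = true U φ
  ξ , i ⊨ `F φ = Σ ℕ λ k → i ≤ k × ξ , k ⊨ φ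
  -- G φ = ¬ F ¬ φ
  ξ , i ⊨ `G φ = ¬ (Σ ℕ λ k → i ≤ k × ¬ (ξ , k ⊨ φ))

  Agrees : {B : List BoolFun} {n : ℕ} → Structure → ℕ → Vec (Formula B) n → Vec Bool n → Set
  Agrees ξ i [] [] = Data.Unit.⊤
    where import Data.Unit
  Agrees ξ i (φ ∷ φs) (b ∷ bs) = ((b ≡ true) ⇔ (ξ , i ⊨ φ)) × Agrees ξ i φs bs

Satisfiable : {B : List BoolFun} → Formula B → Set
Satisfiable φ = Σ Structure λ ξ → Σ ℕ λ i → ξ , i ⊨ φ

-- Encoding of formulae as words over a finite alphabet (Polish notation,
-- variable indices in binary).

data Sym (k : ℕ) : Set where
  sVar sBit1 sBit2 sEnd sF sG sX sU sS : Sym k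
  sConn : Fin k → Sym k

encBin : ∀ {k} → ℕᵇ → List (Sym k)
encBin zero = []
encBin 2[1+ x ] = sBit2 ∷ encBin x
encBin 1+[2 x ] = sBit1 ∷ encBin x

mutual
  encode : {B : List BoolFun} → Formula B → List (Sym (length B))
  encode (var x) = sVar ∷ encBin x ++ (sEnd ∷ [])
  encode (conn c φs) = sConn c ∷ encodeVec φs
  encode (`F φ) = sF ∷ encode φ
  encode (`G φ) = sG ∷ encode φ
  encode (`X φ) = sX ∷ encode φ
  encode (φ `U ψ) = sU ∷ encode φ ++ encode ψ
  encode (φ `S ψ) = sS ∷ encode φ ++ encode ψ

  encodeVec : {B : List BoolFun} {n : ℕ} → Vec (Formula B) n → List (Sym (length B))
  encodeVec [] = []
  encodeVec (φ ∷ φs) = encode φ ++ encodeVec φs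

-- Deterministic single-tape Turing machines (one-way infinite tape)
-- with input alphabet Sym k and extra work symbols Fin Γ.

data Move : Set where
  left right stay : Move

Cell : ℕ → ℕ → Set
Cell k Γ = Maybe (Sym k ⊎ Fin Γ)   -- nothing = blank

record TM (k : ℕ) : Set where
  field
    Q Γ   : ℕ
    start accept reject : Fin Q
    δ     : Fin Q → Cell k Γ → Fin Q × Cell k Γ × Move

record Config (k Q Γ : ℕ) : Set where
  constructor config
  field
    state : Fin Q
    tape  : ℕ → Cell k Γ
    head  : ℕ

module _ {k : ℕ} (M : TM k) where
  open TM M

  open import Data.Fin using (_≟_)
  open import Relation.Nullary using (yes; no)

  Halted : Fin Q → Set
  Halted q = (q ≡ accept) ⊎ (q ≡ reject)

  write : (ℕ → Cell k Γ) → ℕ → Cell k Γ → ℕ → Cell k Γ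
  write t p c j = if j ≡ᵇ p then c else t j

  moveHead : ℕ → Move → ℕ
  moveHead zero left = zero
  moveHead (suc p) left = p
  moveHead p right = suc p
  moveHead p stay = p

  step : Config k Q Γ → Config k Q Γ
  step (config q t p) with q ≟ accept | q ≟ reject
  ... | yes _ | _ = config q t p
  ... | no _ | yes _ = config q t p
  ... | no _ | no _ with δ q (t p)
  ...   | (q' , c , m) = config q' (write t p c) (moveHead p m)

  run : ℕ → Config k Q Γ → Config k Q Γ
  run zero c = c
  run (suc n) c = run n (step c)

  inputTape : List (Sym k) → ℕ → Cell k Γ
  inputTape [] j = nothing
  inputTape (s ∷ w) zero = just (inj₁ s)
  inputTape (s ∷ w) (suc j) = inputTape w j

  initial : List (Sym k) → Config k Q Γ
  initial w = config start (inputTape w) zero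

  DecidesWithin : List (Sym k) → ℕ → Set → Set
  DecidesWithin w t P =
    let q = Config.state (run t (initial w)) in
    Halted q × ((q ≡ accept) ⇔ P)

PolyTimeDecidable : {k : ℕ} → (List (Sym k) → Set) → Set
PolyTimeDecidable {k} L =
  Σ (TM k) λ M → Σ ℕ λ c → Σ ℕ λ d →
    ∀ (w : List (Sym k)) → Σ ℕ λ t → t ≤ c * length w ^ d + c × DecidesWithin M w t (L w)

SATLang : (B : List BoolFun) → List (Sym (length B)) → Set
SATLang B w = Σ (Formula B) λ φ → encode φ ≡ w × Satisfiable φ

{-# OPTIONS --safe #-}
-- In a structure that does not change over time, F, G and X act as the
-- identity and both U and S return their right argument, so every formula can
-- be evaluated there like a Boolean expression.  In any structure U and S take
-- no value that their right argument does not take, and a connective in N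
-- depends on one argument only; hence every value a formula takes anywhere is
-- already taken where all variables are always false or always true.
-- Satisfiability thus amounts to evaluating a formula in Polish notation twice.
-- A Turing machine does this from right to left, using the part of the tape
-- already read as the stack of values; each symbol costs one round trip over
-- that part, which makes the time quadratic.
module Submission where

open import Defs
open import Data.Bool using (Bool; true; false; _∨_; if_then_else_)
open import Data.Bool.Properties using () renaming (_≟_ to _≟ᵇ_)
open import Data.Empty using (⊥-elim)
open import Data.Fin using (Fin; zero; suc)
open import Data.List using (List; []; _∷_; _++_; _ʳ++_; [_]; length; map; replicate; concatMap; allFin; cartesianProduct; cartesianProductWith; catMaybes)
import Data.List as List
open import Data.List.Membership.Propositional using (_∈_; lose)
open import Data.List.Membership.Propositional.Properties using (∈-map⁺; ∈-++⁺ˡ; ∈-++⁺ʳ; ∈-concatMap⁺; ∈-cartesianProduct⁺; ∈-cartesianProductWith⁺; ∈-allFin; ∈-lookup)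
open import Data.List.Properties using (++-assoc; ++-identityʳ; ++-ʳ++; ʳ++-ʳ++; length-reverse)
open import Data.List.Relation.Unary.All using (All)
import Data.List.Relation.Unary.All as All
open import Data.List.Relation.Unary.Any using (here; there; index)
open import Data.List.Relation.Unary.Any.Properties using (lookup-index)
open import Data.Maybe using (Maybe; just; nothing; maybe′)
import Data.Maybe as Maybe
open import Data.Nat using (ℕ; zero; suc; _+_; _*_; _^_; _≤_; z≤n; s≤s; _≡ᵇ_)
open import Data.Nat.Binary using (zero; 2[1+_]; 1+[2_])
open import Data.Nat.Properties
open import Data.Nat.Tactic.RingSolver using (solve-∀)
open import Data.Product using (∃; _×_; _,_; proj₁; proj₂)
open import Data.Sum using (_⊎_; inj₁; inj₂)
open import Data.Unit using (tt)
open import Data.Vec using (Vec; []; _∷_)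
import Data.Vec as Vec
open import Data.Vec.Properties using (lookup-map)
open import Function.Base using (_∘_; id)
open import Function.Bundles using (_⇔_; mk⇔; Equivalence)
open import Relation.Binary.PropositionalEquality using (_≡_; refl; sym; trans; cong; cong₂; subst)
open import Relation.Nullary using (¬_; contradiction)
open import Relation.Nullary.Decidable using (decidable-stable)
open Equivalence using (to; from)

-- Truth values in the two constant structures

Val : Set
Val = Bool × Bool

-- The index `a` selects the structure `constant a`, in which every variable has the value `a` at
-- every state.
at : Bool → Val → Bool
at false = proj₁
at true  = proj₂

sat : Val → Bool
sat (u , v) = u ∨ v

at⇒sat : ∀ a v → at a v ≡ true → sat v ≡ true
at⇒sat false (true , _)     refl = refl
at⇒sat true  (false , true) refl = refl
at⇒sat true  (true , true)  refl = refl

sat⇒at : ∀ v → sat v ≡ true → ∃ λ a → at a v ≡ true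
sat⇒at (true , _)     refl = false , refl
sat⇒at (false , true) refl = true , refl

constant : Bool → Structure
constant a _ _ = a

bool-stable : {b c : Bool} → ¬ ¬ (b ≡ c) → b ≡ c
bool-stable {b} {c} = decidable-stable (b ≟ᵇ c)

-- The claim is a decidable question about booleans. Truth in an arbitrary structure is not
-- decidable, so case distinctions on it are made under a double negation that is removed here.
attained-stable : ∀ {b} v → ¬ ¬ (∃ λ a → b ≡ at a v) → ∃ λ a → b ≡ at a v
attained-stable {true}  (true , _)      _ = false , refl
attained-stable {true}  (false , true)  _ = true , refl
attained-stable {true}  (false , false) h = ⊥-elim (h λ { (false , ()) ; (true , ()) })
attained-stable {false} (false , _)     _ = false , refl
attained-stable {false} (true , false)  _ = true , refl
attained-stable {false} (true , true)   h = ⊥-elim (h λ { (false , ()) ; (true , ()) })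

_Decides_ : Bool → Set → Set
b Decides P = (b ≡ true) ⇔ P

true-decides : {P : Set} → P → true Decides P
true-decides p = mk⇔ (λ _ → p) (λ _ → refl)

false-decides : {P : Set} → ¬ P → false Decides P
false-decides ¬p = mk⇔ (λ ()) (λ p → contradiction p ¬p)

¬¬decides : (P : Set) → ¬ ¬ (∃ λ b → b Decides P)
¬¬decides P h = h (false , false-decides λ p → h (true , true-decides p))

module _ (B : List BoolFun) where

  fun : (c : Fin (length B)) → Vec Bool (arity (List.lookup B c)) → Bool
  fun c = proj₂ (List.lookup B c)

  -- Gathers temporal operators and connectives under one notion of arity, so that a stack evaluator
  -- needs a single reduction rule.
  data Op : Set where
    opF opG opX opU opS : Op
    opC : Fin (length B) → Op

  opArity : Op → ℕ
  opArity opF     = 1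
  opArity opG     = 1
  opArity opX     = 1
  opArity opU     = 2
  opArity opS     = 2
  opArity (opC c) = arity (List.lookup B c)

  opSym : Op → Sym (length B)
  opSym opF     = sF
  opSym opG     = sG
  opSym opX     = sX
  opSym opU     = sU
  opSym opS     = sS
  opSym (opC c) = sConn c

  mk : (o : Op) → Vec (Formula B) (opArity o) → Formula B
  mk opF     (φ ∷ [])     = `F φ
  mk opG     (φ ∷ [])     = `G φ
  mk opX     (φ ∷ [])     = `X φ
  mk opU     (φ ∷ ψ ∷ []) = φ `U ψ
  mk opS     (φ ∷ ψ ∷ []) = φ `S ψ
  mk (opC c) φs           = conn c φs

  apply : (o : Op) → Vec Val (opArity o) → Val
  apply opF     (v ∷ [])     = v
  apply opG     (v ∷ [])     = v
  apply opX     (v ∷ [])     = v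
  apply opU     (_ ∷ v ∷ []) = v
  apply opS     (_ ∷ v ∷ []) = v
  apply (opC c) vs           = fun c (Vec.map (at false) vs) , fun c (Vec.map (at true) vs)

  varVal : Val
  varVal = false , true

  mutual
    eval : Formula B → Val
    eval (var x)     = varVal
    eval (conn c φs) = apply (opC c) (evals φs)
    eval (`F φ)      = eval φ
    eval (`G φ)      = eval φ
    eval (`X φ)      = eval φ
    eval (φ `U ψ)    = eval ψ
    eval (φ `S ψ)    = eval ψ

    evals : ∀ {n} → Vec (Formula B) n → Vec Val n
    evals []       = []
    evals (φ ∷ φs) = eval φ ∷ evals φs

  eval-mk : ∀ o φs → eval (mk o φs) ≡ apply o (evals φs)
  eval-mk opF     (φ ∷ [])     = refl
  eval-mk opG     (φ ∷ [])     = refl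
  eval-mk opX     (φ ∷ [])     = refl
  eval-mk opU     (φ ∷ ψ ∷ []) = refl
  eval-mk opS     (φ ∷ ψ ∷ []) = refl
  eval-mk (opC c) φs           = refl

  encode-mk : ∀ o φs → encode (mk o φs) ≡ opSym o ∷ encodeVec φs
  encode-mk opF     (φ ∷ [])     = cong (sF ∷_) (sym (++-identityʳ _))
  encode-mk opG     (φ ∷ [])     = cong (sG ∷_) (sym (++-identityʳ _))
  encode-mk opX     (φ ∷ [])     = cong (sX ∷_) (sym (++-identityʳ _))
  encode-mk opU     (φ ∷ ψ ∷ []) = cong (λ w → sU ∷ encode φ ++ w) (sym (++-identityʳ _))
  encode-mk opS     (φ ∷ ψ ∷ []) = cong (λ w → sS ∷ encode φ ++ w) (sym (++-identityʳ _))
  encode-mk (opC c) φs           = refl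

  at-conn : ∀ a c vs → at a (apply (opC c) vs) ≡ fun c (Vec.map (at a) vs)
  at-conn false c vs = refl
  at-conn true  c vs = refl

  mutual
    -- The boolean does not mention `i`, so the induction hypothesis at a witness `k` of `F`, `U` or
    -- `S` also settles the state `i`. Conversely `i` itself is a witness, with an empty range left
    -- for the left argument.
    eval-decides : ∀ a i φ → at a (eval φ) Decides (constant a , i ⊨ φ)
    eval-decides false i (var x) = mk⇔ id id
    eval-decides true  i (var x) = mk⇔ id id
    eval-decides a i (conn c φs) = mk⇔
      (λ e → Vec.map (at a) (evals φs) , evals-agree a i φs , trans (sym (at-conn a c (evals φs))) e)
      λ { (bs , agr , e) → trans (at-conn a c (evals φs)) (trans (cong (fun c) (sym (agree-evals a i φs bs agr))) e) }
    eval-decides a i (`F φ) = mk⇔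
      (λ e → i , ≤-refl , to (eval-decides a i φ) e)
      λ { (k , _ , h) → from (eval-decides a k φ) h }
    eval-decides a i (`G φ) = mk⇔
      (λ { e (k , _ , h) → h (to (eval-decides a k φ) e) })
      -- `G` is a negated existential, so its instance at `i` is only doubly negated; equality of
      -- booleans is stable.
      λ h → bool-stable λ ¬e → h (i , ≤-refl , ¬e ∘ from (eval-decides a i φ))
    eval-decides a i (`X φ) = eval-decides a (suc i) φ
    eval-decides a i (φ `U ψ) = mk⇔
      (λ e → i , ≤-refl , to (eval-decides a i ψ) e , λ j i≤j j<i → contradiction i≤j (<⇒≱ j<i))
      λ { (k , _ , h , _) → from (eval-decides a k ψ) h }
    eval-decides a i (φ `S ψ) = mk⇔
      (λ e → i , ≤-refl , to (eval-decides a i ψ) e , λ j i<j j≤i → contradiction j≤i (<⇒≱ i<j))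
      λ { (k , _ , h , _) → from (eval-decides a k ψ) h }

    evals-agree : ∀ a i {n} (φs : Vec (Formula B) n) →
                  Agrees (constant a) i φs (Vec.map (at a) (evals φs))
    evals-agree a i []       = tt
    evals-agree a i (φ ∷ φs) = eval-decides a i φ , evals-agree a i φs

    agree-evals : ∀ a i {n} (φs : Vec (Formula B) n) bs →
                  Agrees (constant a) i φs bs → bs ≡ Vec.map (at a) (evals φs)
    agree-evals a i []       []       _         = refl
    agree-evals a i (φ ∷ φs) (b ∷ bs) (d , agr) =
      cong₂ _∷_ (decided-unique d (eval-decides a i φ)) (agree-evals a i φs bs agr)

    decided-unique : ∀ {b c P} → b Decides P → c Decides P → b ≡ c
    decided-unique {true}  d e = sym (from e (to d refl))
    decided-unique {false} {false} d e = refl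
    decided-unique {false} {true}  d e = from d (to e refl)

  -- Every value taken anywhere is taken in a constant structure

  ¬¬agrees : ∀ ξ i {n} (φs : Vec (Formula B) n) → ¬ ¬ (∃ λ bs → Agrees ξ i φs bs)
  ¬¬agrees ξ i []       h = h ([] , tt)
  ¬¬agrees ξ i (φ ∷ φs) h =
    ¬¬decides (ξ , i ⊨ φ) λ { (b , d) →
    ¬¬agrees ξ i φs λ { (bs , agr) → h (b ∷ bs , d , agr) } }

  module _ (inN : All InN B) where

    mutual
      -- Both truth values are covered because a connective may negate. A true `U` or `S` leads to a
      -- state where its right argument holds; a false one has its right argument false already at
      -- `i`.
      attained : ∀ ξ i b φ → b Decides (ξ , i ⊨ φ) → ∃ λ a → b ≡ at a (eval φ)
      attained ξ i true  (var x)     d = true , refl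
      attained ξ i false (var x)     d = false , refl
      attained ξ i true  (conn c φs) d with to d refl
      ... | bs , agr , e with attained-conn ξ i c φs bs agr
      ...   | a , e′ = a , trans (sym e) e′
      -- Unlike truth, falsity of a connective supplies no vector of argument values; one exists
      -- under double negation.
      attained ξ i false (conn c φs) d = attained-stable (eval (conn c φs)) λ h →
        ¬¬agrees ξ i φs λ { (bs , agr) → h (refute bs agr (attained-conn ξ i c φs bs agr)) }
        where
        refute : ∀ bs → Agrees ξ i φs bs →
                 (∃ λ a → fun c bs ≡ at a (eval (conn c φs))) → ∃ λ a → false ≡ at a (eval (conn c φs))
        refute bs agr (a , e) with fun c bs in eq
        ... | false = a , e
        ... | true  = contradiction (from d (bs , agr , eq)) λ ()
      attained ξ i true  (`F φ)   d with to d refl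
      ... | k , _ , h = attained ξ k true φ (true-decides h)
      attained ξ i false (`F φ)   d =
        attained ξ i false φ (false-decides λ h → contradiction (from d (i , ≤-refl , h)) λ ())
      attained ξ i true  (`G φ)   d = attained-stable (eval φ) λ h →
        to d refl (i , ≤-refl , λ p → h (attained ξ i true φ (true-decides p)))
      attained ξ i false (`G φ)   d = attained-stable (eval φ) λ h →
        contradiction (from d λ { (k , _ , ¬p) → h (attained ξ k false φ (false-decides ¬p)) }) λ ()
      attained ξ i b     (`X φ)   d = attained ξ (suc i) b φ d
      attained ξ i true  (φ `U ψ) d with to d refl
      ... | k , _ , h , _ = attained ξ k true ψ (true-decides h)
      attained ξ i false (φ `U ψ) d = attained ξ i false ψ (false-decides λ h →
        contradiction (from d (i , ≤-refl , h , λ j i≤j j<i → contradiction i≤j (<⇒≱ j<i))) λ ())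
      attained ξ i true  (φ `S ψ) d with to d refl
      ... | k , _ , h , _ = attained ξ k true ψ (true-decides h)
      attained ξ i false (φ `S ψ) d = attained ξ i false ψ (false-decides λ h →
        contradiction (from d (i , ≤-refl , h , λ j i<j j≤i → contradiction j≤i (<⇒≱ i<j))) λ ())

      -- Membership in N enters here: the constant structure that attains the value of the one
      -- relevant argument attains the value of the connective. Two relevant arguments might need
      -- different structures, as in `x ∧ ¬ y`.
      attained-conn : ∀ ξ i c φs bs → Agrees ξ i φs bs →
                      ∃ λ a → fun c bs ≡ at a (eval (conn c φs))
      attained-conn ξ i c φs bs agr with All.lookup inN (∈-lookup {xs = B} c)
      ... | inj₁ const = true , const bs (Vec.map (at true) (evals φs))
      ... | inj₂ (j , dep) with attained-lookup ξ i φs bs agr j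
      ...   | a , e = a , trans
        (dep bs _ (trans e (sym (lookup-map j (at a) (evals φs)))))
        (sym (at-conn a c (evals φs)))

      attained-lookup : ∀ ξ i {n} (φs : Vec (Formula B) n) bs → Agrees ξ i φs bs →
                        ∀ j → ∃ λ a → Vec.lookup bs j ≡ at a (Vec.lookup (evals φs) j)
      attained-lookup ξ i (φ ∷ φs) (b ∷ bs) (d , _)   zero    = attained ξ i b φ d
      attained-lookup ξ i (φ ∷ φs) (b ∷ bs) (_ , agr) (suc j) = attained-lookup ξ i φs bs agr j

    satisfiable⇒sat : ∀ φ → Satisfiable φ → sat (eval φ) ≡ true
    satisfiable⇒sat φ (ξ , i , h) with attained ξ i true φ (true-decides h)
    ... | a , e = at⇒sat a (eval φ) (sym e)

  sat⇒satisfiable : ∀ φ → sat (eval φ) ≡ true → Satisfiable φ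
  sat⇒satisfiable φ h with sat⇒at (eval φ) h
  ... | a , e = constant a , 0 , to (eval-decides a 0 φ) e

-- Evaluating Polish notation from right to left with a stack

pop : {A : Set} (n : ℕ) → List A → Maybe (Vec A n × List A)
pop zero    xs       = just ([] , xs)
pop (suc n) []       = nothing
pop (suc n) (x ∷ xs) = Maybe.map (λ (ys , zs) → x ∷ ys , zs) (pop n xs)

-- A word encodes one formula only if exactly one value remains. The first argument is the entry met
-- so far, which the machine remembers in its `check` states.
final : Maybe Val → List Val → Bool
final nothing  []       = false
final (just v) []       = sat v
final nothing  (v ∷ vs) = final (just v) vs
final (just _) (_ ∷ _)  = false

module _ (B : List BoolFun) where

  bitSym : Bool → Sym (length B)
  bitSym false = sBit2
  bitSym true  = sBit1

  data View : Sym (length B) → Set where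
    op    : ∀ o → View (opSym B o)
    start : View sVar
    bit   : ∀ b → View (bitSym b)
    end   : View sEnd

  view : ∀ s → View s
  view sVar      = start
  view sBit1     = bit true
  view sBit2     = bit false
  view sEnd      = end
  view sF        = op opF
  view sG        = op opG
  view sX        = op opX
  view sU        = op opU
  view sS        = op opS
  view (sConn c) = op (opC c)

  view-op : ∀ o → view (opSym B o) ≡ op o
  view-op opF     = refl
  view-op opG     = refl
  view-op opX     = refl
  view-op opU     = refl
  view-op opS     = refl
  view-op (opC c) = refl

  -- The word is given in reverse; acceptsVar reads inside the index of a
  -- variable, whose end marker comes first.
  mutual
    accepts : List (Sym (length B)) → List Val → Bool
    accepts []      vs = final nothing vs
    accepts (s ∷ w) vs with view s
    ... | op o  = maybe′ (λ (us , vs′) → accepts w (apply B o us ∷ vs′)) false (pop (opArity B o) vs)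
    ... | end   = acceptsVar w vs
    ... | start = false
    ... | bit b = false

    acceptsVar : List (Sym (length B)) → List Val → Bool
    acceptsVar []      vs = false
    acceptsVar (s ∷ w) vs with view s
    ... | op o  = false
    ... | end   = false
    ... | start = accepts w (varVal B ∷ vs)
    ... | bit b = acceptsVar w vs

  -- Completeness: reading a reversed encoding pushes its value

  pop-++ : ∀ {n} (us : Vec Val n) vs → pop n (Vec.toList us ++ vs) ≡ just (us , vs)
  pop-++ []       vs = refl
  pop-++ (u ∷ us) vs rewrite pop-++ us vs = refl

  acceptsVar-encBin : ∀ x w vs → acceptsVar (encBin x ʳ++ w) vs ≡ acceptsVar w vs
  acceptsVar-encBin zero     w vs = refl
  acceptsVar-encBin 2[1+ x ] w vs = acceptsVar-encBin x (sBit2 ∷ w) vs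
  acceptsVar-encBin 1+[2 x ] w vs = acceptsVar-encBin x (sBit1 ∷ w) vs

  accepts-op : ∀ o w us vs →
               accepts (opSym B o ∷ w) (Vec.toList us ++ vs) ≡ accepts w (apply B o us ∷ vs)
  accepts-op o w us vs rewrite view-op o | pop-++ us vs = refl

  accepts-var : ∀ x w vs → accepts (encode {B} (var x) ʳ++ w) vs ≡ accepts w (varVal B ∷ vs)
  accepts-var x w vs rewrite ++-ʳ++ (encBin x) {sEnd ∷ []} {sVar ∷ w} = acceptsVar-encBin x (sVar ∷ w) vs

  mutual
    -- Reversal puts the arguments before their operator and the last argument first, so their
    -- values lie on the stack in argument order when the operator is read. The rest `w` and the
    -- stack `vs` vary for the induction.
    accepts-encode : ∀ φ w vs → accepts (encode φ ʳ++ w) vs ≡ accepts w (eval B φ ∷ vs)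
    accepts-encode (var x)     w vs = accepts-var x w vs
    accepts-encode (conn c φs) w vs =
      trans (accepts-encodeVec φs (sConn c ∷ w) vs) (accepts-op (opC c) w (evals B φs) vs)
    accepts-encode (`F φ)      w vs =
      trans (accepts-encode φ (sF ∷ w) vs) (accepts-op opF w (eval B φ ∷ []) vs)
    accepts-encode (`G φ)      w vs =
      trans (accepts-encode φ (sG ∷ w) vs) (accepts-op opG w (eval B φ ∷ []) vs)
    accepts-encode (`X φ)      w vs =
      trans (accepts-encode φ (sX ∷ w) vs) (accepts-op opX w (eval B φ ∷ []) vs)
    accepts-encode (φ `U ψ)    w vs =
      trans (accepts-encode₂ φ ψ (sU ∷ w) vs) (accepts-op opU w (eval B φ ∷ eval B ψ ∷ []) vs)
    accepts-encode (φ `S ψ)    w vs =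
      trans (accepts-encode₂ φ ψ (sS ∷ w) vs) (accepts-op opS w (eval B φ ∷ eval B ψ ∷ []) vs)

    accepts-encode₂ : ∀ φ ψ w vs → accepts ((encode φ ++ encode ψ) ʳ++ w) vs
                                   ≡ accepts w (eval B φ ∷ eval B ψ ∷ vs)
    accepts-encode₂ φ ψ w vs rewrite ++-ʳ++ (encode φ) {encode ψ} {w} =
      trans (accepts-encode ψ (encode φ ʳ++ w) vs) (accepts-encode φ w (eval B ψ ∷ vs))

    accepts-encodeVec : ∀ {n} (φs : Vec (Formula B) n) w vs →
                        accepts (encodeVec φs ʳ++ w) vs ≡ accepts w (Vec.toList (evals B φs) ++ vs)
    accepts-encodeVec []       w vs = refl
    accepts-encodeVec (φ ∷ φs) w vs rewrite ++-ʳ++ (encode φ) {encodeVec φs} {w} =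
      trans (accepts-encodeVec φs (encode φ ʳ++ w) vs)
            (accepts-encode φ w (Vec.toList (evals B φs) ++ vs))

  -- Soundness: accepted words are encodings

  pop-evals : ∀ n φs → pop n (map (eval B) φs)
                       ≡ Maybe.map (λ (ψs , χs) → evals B ψs , map (eval B) χs) (pop n φs)
  pop-evals zero    φs       = refl
  pop-evals (suc n) []       = refl
  pop-evals (suc n) (φ ∷ φs) rewrite pop-evals n φs with pop n φs
  ... | nothing = refl
  ... | just _  = refl

  pop-encode : ∀ n φs {ψs χs} → pop n φs ≡ just (ψs , χs) →
               concatMap (encode {B}) φs ≡ encodeVec ψs ++ concatMap encode χs
  pop-encode zero    φs       refl = refl
  pop-encode (suc n) (φ ∷ φs) e with pop n φs in eq
  pop-encode (suc n) (φ ∷ φs) refl | just (ψs , χs) =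
    trans (cong (encode φ ++_) (pop-encode n φs eq)) (sym (++-assoc (encode φ) _ _))

  Parse : List (Sym (length B)) → Set
  Parse w = ∃ λ φ → encode {B} φ ≡ w × sat (eval B φ) ≡ true

  mutual
    -- The stack is lifted from values to formulae. The invariant is that the unread part, turned
    -- back around, followed by the codes of these formulae spells the whole word; at the end a
    -- single formula is left as the parse.
    accepts-sound : ∀ w φs → accepts w (map (eval B) φs) ≡ true →
                    Parse (w ʳ++ concatMap encode φs)
    accepts-sound []      (φ ∷ []) h = φ , sym (++-identityʳ _) , h
    accepts-sound (s ∷ w) φs       h with view s
    ... | end  = acceptsVar-sound w zero φs h
    ... | op o rewrite pop-evals (opArity B o) φs with pop (opArity B o) φs in eq
    ...   | just (ψs , χs) = subst (Parse ∘ (w ʳ++_)) prefix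
            (accepts-sound w (mk B o ψs ∷ χs)
              (subst (λ v → accepts w (v ∷ map (eval B) χs) ≡ true) (sym (eval-mk B o ψs)) h))
      where
      prefix : encode (mk B o ψs) ++ concatMap encode χs ≡ opSym B o ∷ concatMap encode φs
      prefix = trans (cong (_++ concatMap encode χs) (encode-mk B o ψs))
                     (cong (opSym B o ∷_) (sym (pop-encode (opArity B o) φs eq)))

    -- `x` is the index read so far. Reading goes backwards, so each new bit becomes the outermost
    -- constructor.
    acceptsVar-sound : ∀ w x φs → acceptsVar w (map (eval B) φs) ≡ true →
                       Parse (w ʳ++ (encBin x ++ sEnd ∷ concatMap encode φs))
    acceptsVar-sound (s ∷ w) x φs h with view s
    ... | start     = subst (λ u → Parse (w ʳ++ (sVar ∷ u)))
                        (++-assoc (encBin x) (sEnd ∷ []) _)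
                        (accepts-sound w (var x ∷ φs) h)
    ... | bit false = acceptsVar-sound w 2[1+ x ] φs h
    ... | bit true  = acceptsVar-sound w 1+[2 x ] φs h

  accepts⇔SATLang : All InN B → ∀ w → (accepts (w ʳ++ []) [] ≡ true) ⇔ SATLang B w
  accepts⇔SATLang inN w = mk⇔ sound complete
    where
    sound : accepts (w ʳ++ []) [] ≡ true → SATLang B w
    sound h with subst Parse (ʳ++-ʳ++ w {[]} {[]}) (accepts-sound (w ʳ++ []) [] h)
    ... | φ , e , s = φ , trans e (++-identityʳ w) , sat⇒satisfiable B φ s
    complete : SATLang B w → accepts (w ʳ++ []) [] ≡ true
    complete (φ , refl , s) = trans (accepts-encode φ [] []) (satisfiable⇒sat B inN φ s)

-- Turing machines over arbitrary finite sets of states and work symbols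

Letter : ℕ → Set → Set
Letter k W = Maybe (Sym k ⊎ W)

-- The tape is `behind` reversed, followed by `ahead`, whose first cell is under the head.
record Zipper (S C : Set) : Set where
  constructor zipper
  field
    state  : S
    behind : List C
    ahead  : List C

leftward : {S C : Set} → S → List C → List C → Zipper S C
leftward s []      R = zipper s [] R
leftward s (c ∷ L) R = zipper s L (c ∷ R)

shift : {S C : Set} → S → List C → C → List C → Move → Zipper S C
shift s L c R left  = leftward s L (c ∷ R)
shift s L c R right = zipper s (c ∷ L) R
shift s L c R stay  = zipper s L (c ∷ R)

Transition : Set → Set → Set
Transition S C = S → C → Bool ⊎ (S × C × Move)

-- `halt` leaves the remaining budget free, so the number is an upper bound on the running time.
data Halts {S C : Set} (δ : Transition S C) (b : Bool) : ℕ → Zipper S C → Set where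
  halt : ∀ {t s L c R} → δ s c ≡ inj₁ b → Halts δ b (suc t) (zipper s L (c ∷ R))
  go   : ∀ {t s L c R s′ c′ m} → δ s c ≡ inj₂ (s′ , c′ , m) →
         Halts δ b t (shift s′ L c′ R m) → Halts δ b (suc t) (zipper s L (c ∷ R))

weaken : ∀ {S C : Set} {δ : Transition S C} {b t t′ z} → t ≤ t′ → Halts δ b t z → Halts δ b t′ z
weaken (s≤s t≤t′) (halt e) = halt e
weaken (s≤s t≤t′) (go e h) = go e (weaken t≤t′ h)

-- Finiteness is given by a complete enumeration, and an element is coded by a position in it. Only
-- decoding after encoding has to be the identity, so repetitions do no harm.
module Simulation (k : ℕ) (S W : Set) (states : List S) (state∈ : ∀ s → s ∈ states) (works : List W) (work∈ : ∀ x → x ∈ works) (first : S) (δ : Transition S (Letter k W)) where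

  encState : S → Fin (length states)
  encState s = index (state∈ s)

  decState : Fin (length states) → S
  decState = List.lookup states

  dec-encState : ∀ s → decState (encState s) ≡ s
  dec-encState s = sym (lookup-index (state∈ s))

  encLetter : Letter k W → Cell k (length works)
  encLetter nothing         = nothing
  encLetter (just (inj₁ s)) = just (inj₁ s)
  encLetter (just (inj₂ x)) = just (inj₂ (index (work∈ x)))

  decLetter : Cell k (length works) → Letter k W
  decLetter nothing         = nothing
  decLetter (just (inj₁ s)) = just (inj₁ s)
  decLetter (just (inj₂ i)) = just (inj₂ (List.lookup works i))

  dec-encLetter : ∀ c → decLetter (encLetter c) ≡ c
  dec-encLetter nothing         = refl
  dec-encLetter (just (inj₁ s)) = refl
  dec-encLetter (just (inj₂ x)) = cong (just ∘ inj₂) (sym (lookup-index (work∈ x)))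

  running : S → Fin (2 + length states)
  running s = suc (suc (encState s))

  verdict : Bool → Fin (2 + length states)
  verdict true  = zero
  verdict false = suc zero

  encAction : Cell k (length works) → Bool ⊎ (S × Letter k W × Move) →
              Fin (2 + length states) × Cell k (length works) × Move
  encAction c (inj₁ b)            = verdict b , c , stay
  encAction c (inj₂ (s , c′ , m)) = running s , encLetter c′ , m

  machine : TM k
  machine = record
    { Q = 2 + length states ; Γ = length works
    ; start = running first ; accept = zero ; reject = suc zero
    ; δ = λ { (suc (suc i)) c → encAction c (δ (decState i) (decLetter c))
            ; q c → q , c , stay }
    }

  -- Agreement of zippers with tapes

  nth : List (Letter k W) → ℕ → Cell k (length works)
  nth []      j       = nothing
  nth (c ∷ w) zero    = encLetter c
  nth (c ∷ w) (suc j) = nth w j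

  nth-ʳ++ : ∀ L R j → nth (L ʳ++ R) (length L + j) ≡ nth R j
  nth-ʳ++ []      R j = refl
  nth-ʳ++ (c ∷ L) R j rewrite sym (+-suc (length L) j) = nth-ʳ++ L (c ∷ R) (suc j)

  Updates : (f g : ℕ → Cell k (length works)) → ℕ → Cell k (length works) → Set
  Updates f g p c = ∀ j → write machine f p c j ≡ g j

  updates-ʳ++ : ∀ L R R′ p c → Updates (nth R) (nth R′) p c →
                Updates (nth (L ʳ++ R)) (nth (L ʳ++ R′)) (length L + p) c
  updates-ʳ++ []      R R′ p c u = u
  updates-ʳ++ (x ∷ L) R R′ p c u rewrite sym (+-suc (length L) p) =
    updates-ʳ++ L (x ∷ R) (x ∷ R′) (suc p) c λ { zero → refl ; (suc j) → u j }

  updates-head : ∀ L c c′ R →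
                 Updates (nth (L ʳ++ (c ∷ R))) (nth (L ʳ++ (c′ ∷ R))) (length L) (encLetter c′)
  updates-head L c c′ R = subst (λ p → Updates (nth (L ʳ++ (c ∷ R))) (nth (L ʳ++ (c′ ∷ R))) p (encLetter c′))
    (+-identityʳ (length L))
    (updates-ʳ++ L (c ∷ R) (c′ ∷ R) 0 (encLetter c′) λ { zero → refl ; (suc j) → refl })

  -- Tapes are functions, so they are compared cell by cell; equality of functions would need
  -- extensionality.
  record Represents (C : Config k (2 + length states) (length works)) (z : Zipper S (Letter k W)) : Set where
    constructor represents
    field
      state≡ : Config.state C ≡ running (Zipper.state z)
      head≡  : Config.head C ≡ length (Zipper.behind z)
      tape≡  : ∀ j → Config.tape C j ≡ nth (Zipper.behind z ʳ++ Zipper.ahead z) j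

  step-running : ∀ s t p c → t p ≡ encLetter c → let q , c′ , m = encAction (encLetter c) (δ s c) in
                 step machine (config (running s) t p) ≡ config q (write machine t p c′) (moveHead machine p m)
  step-running s t p c e rewrite e | dec-encState s | dec-encLetter c = refl

  read-head : ∀ (t : ℕ → Cell k (length works)) {L c R} → (∀ j → t j ≡ nth (L ʳ++ (c ∷ R)) j) →
              t (length L) ≡ encLetter c
  read-head t {L} {c} {R} tape≡ = trans (tape≡ (length L))
    (subst (λ p → nth (L ʳ++ (c ∷ R)) p ≡ encLetter c) (+-identityʳ (length L)) (nth-ʳ++ L (c ∷ R) 0))

  represents-shift : ∀ s t L c R m → (∀ j → t j ≡ nth (L ʳ++ (c ∷ R)) j) →
                     Represents (config (running s) t (moveHead machine (length L) m)) (shift s L c R m)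
  represents-shift s t []      c R left  tape≡ = represents refl refl tape≡
  represents-shift s t (x ∷ L) c R left  tape≡ = represents refl refl tape≡
  represents-shift s t []      c R right tape≡ = represents refl refl tape≡
  represents-shift s t (x ∷ L) c R right tape≡ = represents refl refl tape≡
  represents-shift s t []      c R stay  tape≡ = represents refl refl tape≡
  represents-shift s t (x ∷ L) c R stay  tape≡ = represents refl refl tape≡

  write-head : ∀ (t : ℕ → Cell k (length works)) {L c R} c′ → (∀ j → t j ≡ nth (L ʳ++ (c ∷ R)) j) →
               ∀ j → write machine t (length L) (encLetter c′) j ≡ nth (L ʳ++ (c′ ∷ R)) j
  write-head t {L} {c} {R} c′ tape≡ j =
    trans (cong (if j ≡ᵇ length L then encLetter c′ else_) (tape≡ j)) (updates-head L c c′ R j)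

  run-verdict : ∀ b n t p → Config.state (run machine n (config (verdict b) t p)) ≡ verdict b
  run-verdict true  zero    t p = refl
  run-verdict false zero    t p = refl
  run-verdict true  (suc n) t p = run-verdict true n t p
  run-verdict false (suc n) t p = run-verdict false n t p

  -- A halting action becomes one step into a verdict state, which then persists for the rest of the
  -- budget.
  run-halts : ∀ {b n z C} → Halts δ b n z → Represents C z →
              Config.state (run machine n C) ≡ verdict b
  run-halts {b} {C = config _ t _} (halt {n} {s} {L} {c} e) (represents refl refl tape≡)
    rewrite step-running s t (length L) c (read-head t {L} tape≡) | e = run-verdict b n _ _
  run-halts {C = config _ t _} (go {n} {s} {L} {c} {R} {s′} {c′} {m} e h) (represents refl refl tape≡)
    rewrite step-running s t (length L) c (read-head t {L} tape≡) | e =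
    run-halts h (represents-shift s′ (write machine t (length L) (encLetter c′)) L c′ R m (write-head t {L} c′ tape≡))

  -- The explicit blank gives the head a cell to read at the end of the word.
  input : List (Sym k) → List (Letter k W)
  input w = map (just ∘ inj₁) w ++ [ nothing ]

  inputTape-nth : ∀ w j → inputTape machine w j ≡ nth (input w) j
  inputTape-nth []      zero    = refl
  inputTape-nth []      (suc j) = refl
  inputTape-nth (s ∷ w) zero    = refl
  inputTape-nth (s ∷ w) (suc j) = inputTape-nth w j

  verdict-accept : ∀ b → (verdict b ≡ zero) ⇔ (b ≡ true)
  verdict-accept true  = mk⇔ (λ _ → refl) (λ _ → refl)
  verdict-accept false = mk⇔ (λ ()) (λ ())

  verdict-halted : ∀ b → Halted machine (verdict b)
  verdict-halted true  = inj₁ refl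
  verdict-halted false = inj₂ refl

  decides : ∀ {b n P} w → Halts δ b n (zipper first [] (input w)) → (b ≡ true) ⇔ P →
            DecidesWithin machine w n P
  decides {b} w h eqv rewrite run-halts h (represents refl refl (inputTape-nth w)) =
    verdict-halted b , mk⇔ (to eqv ∘ to (verdict-accept b)) (from (verdict-accept b) ∘ from eqv)

-- The evaluating machine

vals : List Val
vals = cartesianProduct (false ∷ true ∷ []) (false ∷ true ∷ [])

bool∈ : ∀ b → b ∈ false ∷ true ∷ []
bool∈ false = here refl
bool∈ true  = there (here refl)

val∈ : ∀ v → v ∈ vals
val∈ (a , b) = ∈-cartesianProduct⁺ (bool∈ a) (bool∈ b)

-- The arguments gathered so far for an operator of arity `n`. Their number is bounded, so they fit
-- into the finite control.
data Prefix : ℕ → Set where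
  ∅   : ∀ {n} → Prefix n
  _◂_ : ∀ {n} → Val → Prefix n → Prefix (suc n)

prefixes : ∀ n → List (Prefix n)
prefixes zero    = ∅ ∷ []
prefixes (suc n) = ∅ ∷ cartesianProductWith _◂_ vals (prefixes n)

prefix∈ : ∀ {n} (p : Prefix n) → p ∈ prefixes n
prefix∈ {zero}  ∅       = here refl
prefix∈ {suc n} ∅       = here refl
prefix∈         (v ◂ p) = there (∈-cartesianProductWith⁺ _◂_ (val∈ v) (prefix∈ p))

complete : ∀ {n} → Prefix n → Maybe (Vec Val n)
complete {zero}  ∅       = just []
complete {suc n} ∅       = nothing
complete         (v ◂ p) = Maybe.map (v ∷_) (complete p)

-- Leaves a complete prefix unchanged.
push : ∀ {n} → Prefix n → Val → Prefix n
push {zero}  ∅       u = ∅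
push {suc n} ∅       u = u ◂ ∅
push         (v ◂ p) u = v ◂ push p u

-- The outcome of a `pop` that has already taken the values in `p`; by `fill-push` it stays the same
-- while values move from the stack into the prefix.
fill : ∀ {n} → Prefix n → List Val → Maybe (Vec Val n × List Val)
fill {n} ∅       vs = pop n vs
fill     (v ◂ p) vs = Maybe.map (λ (us , ws) → v ∷ us , ws) (fill p vs)

fill-complete : ∀ {n} (p : Prefix n) vs {us} → complete p ≡ just us → fill p vs ≡ just (us , vs)
fill-complete {zero} ∅       vs refl = refl
fill-complete        (v ◂ p) vs e with complete p in eq
fill-complete        (v ◂ p) vs refl | just us rewrite fill-complete p vs eq = refl

fill-[] : ∀ {n} (p : Prefix n) → complete p ≡ nothing → fill p [] ≡ nothing
fill-[] {suc n} ∅       e = refl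
fill-[]         (v ◂ p) e with complete p in eq
... | nothing rewrite fill-[] p eq = refl

fill-push : ∀ {n} (p : Prefix n) u vs → complete p ≡ nothing → fill p (u ∷ vs) ≡ fill (push p u) vs
fill-push {suc n} ∅       u vs e = refl
fill-push         (v ◂ p) u vs e with complete p in eq
... | nothing rewrite fill-push p u vs eq = refl

-- A slot is a cell already read: an entry of the stack, or nothing once that
-- entry has been consumed.
data Work : Set where
  mark : Work
  slot : Maybe Val → Work

slots : List (Maybe Val)
slots = nothing ∷ map just vals

slot∈ : ∀ x → x ∈ slots
slot∈ nothing  = here refl
slot∈ (just v) = there (∈-map⁺ just (val∈ v))

works : List Work
works = mark ∷ map slot slots

work∈ : ∀ x → x ∈ works
work∈ mark     = here refl
work∈ (slot x) = there (∈-map⁺ slot (slot∈ x))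

module _ (B : List BoolFun) where

  -- `toEnd` finds the end of the word; `scan` and `scanVar` read leftwards, outside and inside a
  -- variable; `collect` sweeps right for arguments, `back` carries the result to the mark, and
  -- `check` inspects the final stack.
  data State : Set where
    toEnd scan scanVar : State
    collect : (o : Op B) → Prefix (opArity B o) → State
    back    : Val → State
    check   : Maybe Val → State

  ops : List (Op B)
  ops = opF ∷ opG ∷ opX ∷ opU ∷ opS ∷ map opC (allFin (length B))

  op∈ : ∀ o → o ∈ ops
  op∈ opF     = here refl
  op∈ opG     = there (here refl)
  op∈ opX     = there (there (here refl))
  op∈ opU     = there (there (there (here refl)))
  op∈ opS     = there (there (there (there (here refl))))
  op∈ (opC c) = there (there (there (there (there (∈-map⁺ opC (∈-allFin c))))))

  collects : Op B → List State
  collects o = map (collect o) (prefixes (opArity B o))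

  states : List State
  states = toEnd ∷ scan ∷ scanVar ∷ concatMap collects ops ++ map back vals ++ map check slots

  state∈ : ∀ s → s ∈ states
  state∈ toEnd         = here refl
  state∈ scan          = there (here refl)
  state∈ scanVar       = there (there (here refl))
  state∈ (collect o p) = there (there (there (∈-++⁺ˡ
    (∈-concatMap⁺ collects (lose (op∈ o) (∈-map⁺ (collect o) (prefix∈ p)))))))
  state∈ (back v)      = there (there (there (∈-++⁺ʳ (concatMap collects ops) (∈-++⁺ˡ (∈-map⁺ back (val∈ v))))))
  state∈ (check x)     = there (there (there (∈-++⁺ʳ (concatMap collects ops) (∈-++⁺ʳ (map back vals) (∈-map⁺ check (slot∈ x))))))

  Tape : Set
  Tape = Letter (length B) Work

  pattern symbol s = just (inj₁ s)
  pattern marked   = just (inj₂ mark)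
  pattern stored x = just (inj₂ (slot x))

  Action : Set
  Action = Bool ⊎ (State × Tape × Move)

  scanAction : ∀ {s} → View B s → Action
  scanAction (op o)  = inj₂ (collect o ∅ , marked , right)
  scanAction end     = inj₂ (scanVar , stored nothing , left)
  scanAction start   = inj₁ false
  scanAction (bit b) = inj₁ false

  scanVarAction : ∀ {s} → View B s → Action
  scanVarAction (op o)  = inj₁ false
  scanVarAction end     = inj₁ false
  scanVarAction start   = inj₂ (scan , stored (just (varVal B)) , left)
  scanVarAction (bit b) = inj₂ (scanVar , stored nothing , left)

  collectAction : (o : Op B) → Prefix (opArity B o) → Tape → Maybe (Vec Val (opArity B o)) → Action
  -- Completeness is tested before the cell is consumed, so a nullary operator turns back to the
  -- mark at once.
  collectAction o p c                 (just us) = inj₂ (back (apply B o us) , c , left)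
  collectAction o p (stored nothing)  nothing   = inj₂ (collect o p , stored nothing , right)
  collectAction o p (stored (just v)) nothing   = inj₂ (collect o (push p v) , stored nothing , right)
  collectAction o p _                 nothing   = inj₁ false

  -- The head cannot move left of cell 0, so scan and scanVar meet a stored
  -- cell exactly when the whole word has been read.
  δ : Transition State Tape
  δ toEnd            (symbol s)        = inj₂ (toEnd , symbol s , right)
  δ toEnd            c                 = inj₂ (scan , c , left)
  δ scan             (symbol s)        = scanAction (view B s)
  δ scan             c                 = inj₂ (check nothing , c , stay)
  δ scanVar          (symbol s)        = scanVarAction (view B s)
  δ scanVar          c                 = inj₁ false
  δ (collect o p)    c                 = collectAction o p c (complete p)
  δ (back v)         marked            = inj₂ (scan , stored (just v) , left)
  δ (back v)         c                 = inj₂ (back v , c , left)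
  δ (check x)        (stored nothing)  = inj₂ (check x , stored nothing , right)
  δ (check nothing)  (stored (just v)) = inj₂ (check (just v) , stored (just v) , right)
  δ (check (just _)) (stored (just _)) = inj₁ false
  δ (check x)        c                 = inj₁ (final x [])

  -- Correctness and running time of the evaluating machine

  letters : List (Sym (length B)) → List Tape
  letters = map (just ∘ inj₁)

  stack : List (Maybe Val) → List Tape
  stack R = map (just ∘ inj₂ ∘ slot) R ++ [ nothing ]

  check-halts : ∀ x L R → Halts δ (final x (catMaybes R)) (suc (length R)) (zipper (check x) L (stack R))
  check-halts nothing  L []            = halt refl
  check-halts (just v) L []            = halt refl
  check-halts nothing  L (nothing ∷ R) = go refl (check-halts nothing _ R)
  check-halts (just v) L (nothing ∷ R) = go refl (check-halts (just v) _ R)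
  check-halts nothing  L (just v ∷ R)  = go refl (check-halts (just v) _ R)
  check-halts (just u) L (just v ∷ R)  = halt refl

  scanned : List (Sym (length B)) → List (Maybe Val) → Zipper State Tape
  scanned w R = leftward scan (letters w) (stack R)

  -- One round trip for an operator, with the scan of the rest abstracted to `continue` and its time
  -- `t`. At most `n` cells lie right of the mark; the mark's own cell, once it holds the result,
  -- makes `suc n`.
  module _ (w : List (Sym (length B))) (n t : ℕ) (continue : List Val → Bool)
           (continue-halts : ∀ R → length R ≤ suc n → Halts δ (continue (catMaybes R)) t (scanned w R)) where

    leftPart : ℕ → List Tape
    leftPart a = replicate a (stored nothing) ++ marked ∷ letters w

    back-halts : ∀ v a R → a + length R ≤ n →
                 Halts δ (continue (v ∷ catMaybes R)) (suc a + t) (leftward (back v) (leftPart a) (stack R))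
    back-halts v zero    R le = go refl (continue-halts (just v ∷ R) (s≤s le))
    back-halts v (suc a) R le = go refl (back-halts v a (nothing ∷ R) (subst (_≤ n) (sym (+-suc a (length R))) le))

    -- `length R` pays for the sweep ahead, `2 + n` for turning and for going back over `a` emptied
    -- cells and the mark. Emptied cells vanish under `catMaybes`, so the stack is already correct.
    collect-halts : ∀ o p a R → a + length R ≤ n →
      Halts δ (maybe′ (λ (us , vs) → continue (apply B o us ∷ vs)) false (fill p (catMaybes R)))
              (length R + (2 + n + t)) (zipper (collect o p) (leftPart a) (stack R))
    collect-halts o p a R le with complete p in eq
    collect-halts o p a R le | just us rewrite fill-complete p (catMaybes R) eq =
      weaken (≤-trans (+-monoˡ-≤ t (s≤s (s≤s (≤-trans (m≤m+n a (length R)) le)))) (m≤n+m _ (length R)))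
             (turn R (back-halts (apply B o us) a R le))
      where
      turn : ∀ R {b i L} → Halts δ b i (leftward (back (apply B o us)) L (stack R)) →
             Halts δ b (suc i) (zipper (collect o p) L (stack R))
      turn []      h = go (cong (collectAction o p nothing) eq) h
      turn (x ∷ R) h = go (cong (collectAction o p (stored x)) eq) h
    collect-halts o p a [] le | nothing rewrite fill-[] p eq =
      halt (cong (collectAction o p nothing) eq)
    collect-halts o p a (nothing ∷ R) le | nothing =
      go (cong (collectAction o p (stored nothing)) eq)
         (collect-halts o p (suc a) R (subst (_≤ n) (+-suc a (length R)) le))
    collect-halts o p a (just v ∷ R) le | nothing rewrite fill-push p v (catMaybes R) eq =
      go (cong (collectAction o p (stored (just v))) eq)
         (collect-halts o (push p v) (suc a) R (subst (_≤ n) (+-suc a (length R)) le))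

  module _ (n : ℕ) where

    -- A symbol costs at most one step to mark it and `2 + n + n` for the round trip; the last
    -- `2 + n` pays for entering `check` and its sweep.
    scanTime : List (Sym (length B)) → ℕ
    scanTime w = length w * (3 + n + n) + (2 + n)

    scanTime-∷ : ∀ s w {c} → c ≤ 3 + n + n → c + scanTime w ≤ scanTime (s ∷ w)
    scanTime-∷ s w {c} le = ≤-trans (+-monoˡ-≤ (scanTime w) le)
      (≤-reflexive (sym (+-assoc (3 + n + n) (length w * (3 + n + n)) (2 + n))))

    shift-≤ : ∀ (w : List (Sym (length B))) (R : List (Maybe Val)) →
              suc (length w) + length R ≤ n → length w + suc (length R) ≤ n
    shift-≤ w R = subst (_≤ n) (sym (+-suc (length w) (length R)))

    mutual
      scan-halts : ∀ w R → length w + length R ≤ n →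
                   Halts δ (accepts B w (catMaybes R)) (scanTime w) (scanned w R)
      scan-halts [] R le = weaken (s≤s (s≤s le)) (turn R (check-halts nothing [] R))
        where
        turn : ∀ R {b i} → Halts δ b i (zipper (check nothing) [] (stack R)) →
               Halts δ b (suc i) (zipper scan [] (stack R))
        turn []      h = go refl h
        turn (x ∷ R) h = go refl h
      scan-halts (s ∷ w) R le with view B s in eq
      ... | end   = weaken (scanTime-∷ s w (s≤s z≤n))
                      (go (cong scanAction eq) (scanVar-halts w R (shift-≤ w R le)))
      ... | start = halt (cong scanAction eq)
      ... | bit b = halt (cong scanAction eq)
      ... | op o  = weaken (≤-trans (≤-reflexive (cong suc (regroup (length R) (scanTime w))))
                                     (scanTime-∷ s w (s≤s (s≤s (s≤s (+-mono-≤ R≤n R≤n))))))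
                      (go (cong scanAction eq)
                        -- The bound is the present `length R`, not `n`: the stack grown by the
                        -- operator's cell must still fit beside `w`.
                        (collect-halts w (length R) (scanTime w) (accepts B w)
                          (λ R′ le′ → scan-halts w R′ (≤-trans (+-monoʳ-≤ (length w) le′) (shift-≤ w R le)))
                          o ∅ 0 R ≤-refl))
        where
        R≤n : length R ≤ n
        R≤n = ≤-trans (m≤n+m (length R) (suc (length w))) le
        regroup : ∀ r t → r + (2 + r + t) ≡ 2 + (r + r) + t
        regroup = solve-∀

      scanVar-halts : ∀ w R → length w + suc (length R) ≤ n →
                      Halts δ (acceptsVar B w (catMaybes R)) (scanTime w) (leftward scanVar (letters w) (stack (nothing ∷ R)))
      scanVar-halts []      R le = halt refl
      scanVar-halts (s ∷ w) R le with view B s in eq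
      ... | op o  = halt (cong scanVarAction eq)
      ... | end   = halt (cong scanVarAction eq)
      ... | start = weaken (scanTime-∷ s w (s≤s z≤n))
                      (go (cong scanVarAction eq)
                        (scan-halts w (just (varVal B) ∷ nothing ∷ R) (shift-≤ w (nothing ∷ R) le)))
      ... | bit b = weaken (scanTime-∷ s w (s≤s z≤n))
                      (go (cong scanVarAction eq) (scanVar-halts w (nothing ∷ R) (shift-≤ w (nothing ∷ R) le)))

  toEnd-halts : ∀ {b t} w u → Halts δ b t (scanned (w ʳ++ u) []) →
                Halts δ b (suc (length w) + t) (zipper toEnd (letters u) (letters w ++ [ nothing ]))
  toEnd-halts []      u h = go refl h
  toEnd-halts (s ∷ w) u h = go refl (toEnd-halts w (s ∷ u) h)

-- `suc n` steps reach the end of the word and turn; the rest is `scanTime`. Absorbing `5 * n` into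
-- `n ^ 2` gives the coefficient 7.
time-bound : ∀ n → suc n + (n * (3 + n + n) + (2 + n)) ≤ 7 * n ^ 2 + 7
time-bound n = begin
  suc n + (n * (3 + n + n) + (2 + n)) ≡⟨ expand n ⟩
  2 * n ^ 2 + 5 * n + 3               ≤⟨ +-mono-≤ (+-monoʳ-≤ (2 * n ^ 2) (*-monoʳ-≤ 5 (n≤n^2 n))) (m≤m+n 3 4) ⟩
  2 * n ^ 2 + 5 * n ^ 2 + 7           ≡⟨ cong (_+ 7) (*-distribʳ-+ (n ^ 2) 2 5) ⟨
  7 * n ^ 2 + 7                       ∎
  where
  open ≤-Reasoning
  expand : ∀ n → suc n + (n * (3 + n + n) + (2 + n)) ≡ 2 * (n * (n * 1)) + 5 * n + 3
  expand = solve-∀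
  n≤n^2 : ∀ n → n ≤ n ^ 2
  n≤n^2 zero    = z≤n
  n≤n^2 (suc n) = m≤m*n (suc n) (suc n * 1)

theorem3p6 : (B : List BoolFun) → All InN B → PolyTimeDecidable (SATLang B)
theorem3p6 B inN = machine , 7 , 2 , λ w →
  7 * length w ^ 2 + 7 , ≤-refl ,
  decides w (weaken (bound w) (toEnd-halts B w [] (scan-halts B (length w) (w ʳ++ []) [] (fits w))))
    (accepts⇔SATLang B inN w)
  where
  open Simulation (length B) (State B) Work (states B) (state∈ B) works work∈ toEnd (δ B)
  fits : ∀ (w : List (Sym (length B))) → length (w ʳ++ []) + 0 ≤ length w
  fits w = ≤-reflexive (trans (+-identityʳ _) (length-reverse w))
  bound : ∀ w → suc (length w) + scanTime B (length w) (w ʳ++ []) ≤ 7 * length w ^ 2 + 7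
  bound w rewrite length-reverse w = time-bound (length w)
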